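{- Let $\mathcal I$ be a CSP instance in which the domain of every variable is the $8$-element dihedral group $\mathbf D_4$ (the symmetry group of a square) and every constraint is of the form $x_1x_2\dots x_n\in R$, where $R$ is a coset of a subgroup of $\mathbf D_4^n$. Let $\mathcal D=\mathrm{lc}(\mathcal I)$ be the associated LC instance, with variable set $X$. Suppose that there exist $N\in\mathbb N$, a vector $\mathbf i\in\mathbb Z_2^N$, and functions $\mathbf v_x:\mathcal D_x\to\mathbb Z_2^N$ ($x\in X$) such that: (1) the sum of the coordinates of $\mathbf i$ is $1$ in $\mathbb Z_2$, and $\sum_{a\in\mathcal D_x}\mathbf v_x(a)=\mathbf i$ for every $x\in X$; (2) $\mathbf v_x(a)\cdot\mathbf v_x(b)=0$ for every $x\in X$ and all distinct $a,b\in\mathcal D_x$, where $\cdot$ is the standard dot product on $\mathbb Z_2^N$; (3) for every constraint $x=\alpha(y)$ of $\mathcal D$ and every $a\in\mathcal D_x$, $\mathbf v_x(a)=\sum_{b\in\alpha^{ -1}(a)}\mathbf v_y(b)$ in $\mathbb Z_2^N$. Then $\mathcal I$ has a solution.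
   Context: A CSP instance $\mathcal I$ consists of a finite set of variables, a finite domain for each variable, and a finite list of constraints $x_1x_2\dots x_n\in R$, where $R$ is a subset of the product of the domains of $x_1,\dots,x_n$ (the arity $n$ may depend on the constraint). A solution assigns to each variable an element of its domain so that, for each constraint, the tuple of values of $x_1,\dots,x_n$ lies in $R$. An LC (label cover) instance $\mathcal D$ consists of a finite set $X$ of variables, a finite set $\mathcal D_x$ (domain) for each $x\in X$, and a finite list of constraints of the form $x=\alpha(y)$ with $x,y\in X$ and $\alpha:\mathcal D_y\to\mathcal D_x$ a function. The LC instance $\mathrm{lc}(\mathcal I)$ associated with a CSP instance $\mathcal I$ has as variables the variables of $\mathcal I$, with the same domains, together with one additional variable for each constraint of $\mathcal I$: for a constraint $x_1x_2\dots x_n\in R$ the new variable $y$ has domain $R$, and one imposes the constraints $x_i=\pi_i(y)$ for $i=1,\dots,n$, where $\pi_i:R\to\mathbf D_4$ is the projection to the $i$-th coordinate. -}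

module Defs where

open import Algebra.Bundles using (Group; CommutativeRing)
import Algebra.Construct.Pointwise as Pointwise
open import Algebra.Definitions.RawMonoid using (sum)
open import Data.Bool.Base using (Bool; T)
open import Data.Bool.Properties using (T-irrelevant; T?; xor-∧-commutativeRing)
open import Data.Fin.Base using (Fin; zero; toℕ)
import Data.Fin.Properties as Fin
open import Data.List.Base as List
  using (List; []; _∷_; _++_; map; foldr; filter; allFin; tabulate; concat;
         cartesianProductWith; length)
open import Data.List.Membership.Propositional using (_∈_)
open import Data.List.Membership.Propositional.Properties
  using (∈-map⁺; ∈-map⁻; ∈-++⁺ˡ; ∈-++⁺ʳ; ∈-allFin; ∈-cartesianProductWith⁺)
open import Data.List.Relation.Unary.All as All using (All; []; _∷_)
open import Data.List.Relation.Unary.Any using (here; there)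
open import Data.List.Relation.Unary.AllPairs using ([]; _∷_)
open import Data.List.Relation.Unary.Unique.Propositional using (Unique)
import Data.List.Relation.Unary.Unique.Propositional.Properties as Unique
open import Data.Nat.Base using (ℕ; _+_; _∸_)
open import Data.Nat.DivMod using (_mod_)
open import Data.Product.Base using (Σ; ∃; _×_; _,_; proj₁; proj₂)
open import Data.Product.Properties using (Σ-≡,≡→≡)
open import Data.Sum.Base using (_⊎_; inj₁; inj₂)
import Data.Sum.Properties as Sum
open import Data.Vec.Base as Vec using (Vec)
open import Data.Vec.Functional using (Vector; zipWith)
import Data.Vec.Relation.Unary.All as VecAll
open import Data.Vec.Relation.Unary.All.Properties using (lookup⁺; lookup⁻)
open import Function.Base using (_∘_)
open import Function.Bundles using (_⇔_)
open import Level using (0ℓ)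
open import Relation.Binary.Definitions using (DecidableEquality)
open import Relation.Binary.PropositionalEquality
  using (_≡_; refl; cong; cong₂; isEquivalence)
open import Relation.Nullary using (¬_; Dec; yes; no; contradiction)
open import Relation.Nullary.Decidable using (map′; _×-dec_; from-yes)
open import Relation.Unary using (Pred)

record FinSet : Set₁ where
  infix 4 _≟_
  field
    Carrier  : Set
    _≟_      : DecidableEquality Carrier
    elements : List Carrier
    complete : ∀ a → a ∈ elements
    unique   : Unique elements

open FinSet public using (Carrier; elements)

finFinSet : ℕ → FinSet
finFinSet n = record
  { Carrier  = Fin n
  ; _≟_      = Fin._≟_
  ; elements = allFin n
  ; complete = ∈-allFin
  ; unique   = Unique.allFin⁺ n
  }

infixr 1 _⊎ᶠ_

_⊎ᶠ_ : FinSet → FinSet → FinSet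
A ⊎ᶠ B = record
  { Carrier  = Carrier A ⊎ Carrier B
  ; _≟_      = Sum.≡-dec A._≟_ B._≟_
  ; elements = map inj₁ A.elements ++ map inj₂ B.elements
  ; complete = λ where
      (inj₁ a) → ∈-++⁺ˡ (∈-map⁺ inj₁ (A.complete a))
      (inj₂ b) → ∈-++⁺ʳ _ (∈-map⁺ inj₂ (B.complete b))
  ; unique   = Unique.++⁺ (Unique.map⁺ Sum.inj₁-injective A.unique)
                          (Unique.map⁺ Sum.inj₂-injective B.unique)
                          disjoint
  }
  where
  module A = FinSet A
  module B = FinSet B

  disjoint : ∀ {x} → ¬ (x ∈ map inj₁ A.elements × x ∈ map inj₂ B.elements)
  disjoint (p , q) with ∈-map⁻ inj₁ p | ∈-map⁻ inj₂ q
  ... | _ , _ , refl | _ , _ , ()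

module _ {A : Set} (χ : A → Bool) where

  comprehension : List A → List (∃ (T ∘ χ))
  comprehension [] = []
  comprehension (x ∷ xs) with T? (χ x)
  ... | yes p = (x , p) ∷ comprehension xs
  ... | no  _ = comprehension xs

  ∈-comprehension : ∀ {x xs} (p : T (χ x)) → x ∈ xs → (x , p) ∈ comprehension xs
  ∈-comprehension {xs = y ∷ _} p x∈ with T? (χ y) | x∈
  ... | yes q | here refl = here (cong (_ ,_) (T-irrelevant p q))
  ... | yes _ | there x∈′ = there (∈-comprehension p x∈′)
  ... | no ¬q | here refl = contradiction p ¬q
  ... | no  _ | there x∈′ = ∈-comprehension p x∈′

  comprehension-All : ∀ {P : Pred A 0ℓ} {xs} → All P xs →
                      All (P ∘ proj₁) (comprehension xs)
  comprehension-All [] = []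
  comprehension-All {xs = x ∷ _} (px ∷ pxs) with T? (χ x)
  ... | yes _ = px ∷ comprehension-All pxs
  ... | no  _ = comprehension-All pxs

  comprehension-unique : ∀ {xs} → Unique xs → Unique (comprehension xs)
  comprehension-unique [] = []
  comprehension-unique {x ∷ _} (x∉ ∷ u) with T? (χ x)
  ... | yes _ = All.map (_∘ cong proj₁) (comprehension-All x∉) ∷ comprehension-unique u
  ... | no  _ = comprehension-unique u

subset : (A : FinSet) → (Carrier A → Bool) → FinSet
subset A χ = record
  { Carrier  = ∃ (T ∘ χ)
  ; _≟_      = λ (a , p) (b , q) →
      map′ (λ a≡b → Σ-≡,≡→≡ (a≡b , T-irrelevant _ _)) (cong proj₁) (a A.≟ b)
  ; elements = comprehension χ A.elements
  ; complete = λ (a , p) → ∈-comprehension χ p (A.complete a)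
  ; unique   = comprehension-unique χ A.unique
  }
  where module A = FinSet A

module _ {I : Set} (Dom : I → FinSet) where
  open VecAll using ([]; _∷_)

  private
    ∷-injective : ∀ {n x} {xs : Vec I n} {a b : Carrier (Dom x)}
                  {as bs : VecAll.All (Carrier ∘ Dom) xs} →
                  a VecAll.∷ as ≡ b ∷ bs → a ≡ b × as ≡ bs
    ∷-injective refl = refl , refl

    _≟ᵗ_ : ∀ {n} {xs : Vec I n} → DecidableEquality (VecAll.All (Carrier ∘ Dom) xs)
    []       ≟ᵗ []       = yes refl
    _≟ᵗ_ {xs = x Vec.∷ _} (a ∷ as) (b ∷ bs) =
      map′ (λ (p , q) → cong₂ _∷_ p q) ∷-injective (FinSet._≟_ (Dom x) a b ×-dec (as ≟ᵗ bs))

  tuples : ∀ {n} (xs : Vec I n) → List (VecAll.All (Carrier ∘ Dom) xs)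
  tuples Vec.[]       = [] ∷ []
  tuples (x Vec.∷ xs) = cartesianProductWith _∷_ (elements (Dom x)) (tuples xs)

  private
    ∈-tuples : ∀ {n} {xs : Vec I n} as → as ∈ tuples xs
    ∈-tuples []                      = here refl
    ∈-tuples {xs = x Vec.∷ _} (a ∷ as) =
      ∈-cartesianProductWith⁺ _∷_ (FinSet.complete (Dom x) a) (∈-tuples as)

    tuples-unique : ∀ {n} (xs : Vec I n) → Unique (tuples xs)
    tuples-unique Vec.[]       = [] ∷ []
    tuples-unique (x Vec.∷ xs) = Unique.cartesianProductWith⁺ _∷_ ∷-injective
      (FinSet.unique (Dom x)) (tuples-unique xs)

  -- The product Dom x₁ × … × Dom xₙ; the indices may repeat.
  ∏ᶠ : ∀ {n} → Vec I n → FinSet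
  ∏ᶠ xs = record
    { Carrier  = VecAll.All (Carrier ∘ Dom) xs
    ; _≟_      = _≟ᵗ_
    ; elements = tuples xs
    ; complete = ∈-tuples
    ; unique   = tuples-unique xs
    }

record Constraint (V : FinSet) (Dom : Carrier V → FinSet) : Set where
  field
    {arity}  : ℕ
    scope    : Vec (Carrier V) arity
    -- Characteristic function of R.
    relation : Carrier (∏ᶠ Dom scope) → Bool

record CSP (V : FinSet) (Dom : Carrier V → FinSet) : Set where
  field
    constraints : List (Constraint V Dom)

module _ {V : FinSet} {Dom : Carrier V → FinSet} where

  Satisfies : (∀ x → Carrier (Dom x)) → Constraint V Dom → Set
  Satisfies s C = T (relation (VecAll.universal s scope))
    where open Constraint C

  IsSolution : CSP V Dom → (∀ x → Carrier (Dom x)) → Set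
  IsSolution I s = All (Satisfies s) (CSP.constraints I)

-- The constraint x = α y.
record LCConstraint (X : FinSet) (Dom : Carrier X → FinSet) : Set where
  field
    x y : Carrier X
    α   : Carrier (Dom y) → Carrier (Dom x)

record LC : Set₁ where
  field
    X           : FinSet
    Dom         : Carrier X → FinSet
    constraints : List (LCConstraint X Dom)

lc : ∀ {V Dom} → CSP V Dom → LC
lc {V} {Dom} I = record
  { X           = X′
  ; Dom         = Dom′
  ; constraints = concat (tabulate λ c → tabulate λ i → projection c i)
  }
  where
  open CSP I
  open Constraint

  X′ : FinSet
  X′ = V ⊎ᶠ finFinSet (length constraints)

  Dom′ : Carrier X′ → FinSet
  Dom′ (inj₁ x) = Dom x
  Dom′ (inj₂ c) = subset (∏ᶠ Dom (scope C)) (relation C)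
    where C = List.lookup constraints c

  projection : (c : Fin (length constraints)) →
               Fin (arity (List.lookup constraints c)) → LCConstraint X′ Dom′
  projection c i = record
    { x = inj₁ (Vec.lookup (scope (List.lookup constraints c)) i)
    ; y = inj₂ c
    ; α = λ (t , _) → lookup⁺ t i
    }

module _ (G : Group 0ℓ 0ℓ) where
  open Group G renaming (Carrier to ∣G∣)

  record IsSubgroup (H : Pred ∣G∣ 0ℓ) : Set where
    field
      respects  : ∀ {g h} → g ≈ h → H g → H h
      ε-closed  : H ε
      ∙-closed  : ∀ {g h} → H g → H h → H (g ∙ h)
      ⁻¹-closed : ∀ {g} → H g → H (g ⁻¹)

  -- Left cosets; a right coset H g is the left coset g (g⁻¹ H g) of a
  -- conjugate subgroup, so nothing is lost.
  IsCoset : Pred ∣G∣ 0ℓ → Set₁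
  IsCoset S = Σ (Pred ∣G∣ 0ℓ) λ H → IsSubgroup H ×
    Σ ∣G∣ λ g → ∀ x → S x ⇔ (∃ λ h → H h × x ≈ g ∙ h)

infixl 6 _+₄_ _-₄_

_+₄_ _-₄_ : Fin 4 → Fin 4 → Fin 4
k +₄ l = (toℕ k + toℕ l) mod 4
k -₄ l = (toℕ k + (4 ∸ toℕ l)) mod 4

-- With the vertices of the square labelled cyclically by ℤ/4, rot k is the
-- rotation v ↦ k + v and ref k is the reflection v ↦ k - v.
data D₄ : Set where
  rot ref : Fin 4 → D₄

infixl 7 _∙_

_∙_ : D₄ → D₄ → D₄
rot k ∙ rot l = rot (k +₄ l)
rot k ∙ ref l = ref (k +₄ l)
ref k ∙ rot l = ref (k -₄ l)
ref k ∙ ref l = rot (k -₄ l)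

1D₄ : D₄
1D₄ = rot zero

infix 8 _⁻¹

_⁻¹ : D₄ → D₄
rot k ⁻¹ = rot (zero -₄ k)
ref k ⁻¹ = ref k

∀D₄? : ∀ {P : Pred D₄ 0ℓ} → (∀ g → Dec (P g)) → Dec (∀ g → P g)
∀D₄? P? = map′ (λ (p , q) → λ where (rot k) → p k; (ref k) → q k)
               (λ p → p ∘ rot , p ∘ ref)
               (Fin.all? (P? ∘ rot) ×-dec Fin.all? (P? ∘ ref))

rot-injective : ∀ {k l} → rot k ≡ rot l → k ≡ l
rot-injective refl = refl

ref-injective : ∀ {k l} → ref k ≡ ref l → k ≡ l
ref-injective refl = refl

infix 4 _≟D₄_

_≟D₄_ : DecidableEquality D₄
rot k ≟D₄ rot l = map′ (cong rot) rot-injective (k Fin.≟ l)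
rot k ≟D₄ ref l = no λ ()
ref k ≟D₄ rot l = no λ ()
ref k ≟D₄ ref l = map′ (cong ref) ref-injective (k Fin.≟ l)

D₄-group : Group 0ℓ 0ℓ
D₄-group = record
  { Carrier = D₄
  ; _≈_     = _≡_
  ; _∙_     = _∙_
  ; ε       = 1D₄
  ; _⁻¹     = _⁻¹
  ; isGroup = record
    { isMonoid = record
      { isSemigroup = record
        { isMagma = record { isEquivalence = isEquivalence ; ∙-cong = cong₂ _∙_ }
        ; assoc   = from-yes (∀D₄? λ f → ∀D₄? λ g → ∀D₄? λ h →
                      (f ∙ g) ∙ h ≟D₄ f ∙ (g ∙ h))
        }
      ; identity = from-yes (∀D₄? λ g → 1D₄ ∙ g ≟D₄ g)
                 , from-yes (∀D₄? λ g → g ∙ 1D₄ ≟D₄ g)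
      }
    ; inverse = from-yes (∀D₄? λ g → g ⁻¹ ∙ g ≟D₄ 1D₄)
              , from-yes (∀D₄? λ g → g ∙ g ⁻¹ ≟D₄ 1D₄)
    ; ⁻¹-cong = cong _⁻¹
    }
  }

D₄-finSet : FinSet
D₄-finSet = record
  { Carrier  = D₄
  ; _≟_      = _≟D₄_
  ; elements = map rot (allFin 4) ++ map ref (allFin 4)
  ; complete = λ where
      (rot k) → ∈-++⁺ˡ (∈-map⁺ rot (∈-allFin k))
      (ref k) → ∈-++⁺ʳ (map rot (allFin 4)) (∈-map⁺ ref (∈-allFin k))
  ; unique   = Unique.++⁺ (Unique.map⁺ rot-injective (Unique.allFin⁺ 4))
                          (Unique.map⁺ ref-injective (Unique.allFin⁺ 4))
                          disjoint
  }
  where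
  disjoint : ∀ {x} → ¬ (x ∈ map rot (allFin 4) × x ∈ map ref (allFin 4))
  disjoint (p , q) with ∈-map⁻ rot p | ∈-map⁻ ref q
  ... | _ , _ , refl | _ , _ , ()

-- The power D₄ⁿ is the group of functions Fin n → D₄.
IsCosetConstraint : ∀ {V} → Constraint V (λ _ → D₄-finSet) → Set₁
IsCosetConstraint C =
  IsCoset (Pointwise.group (Fin arity) D₄-group) (λ t → T (relation (lookup⁻ t)))
  where open Constraint C

-- The field ℤ/2 is (Bool, xor, ∧).
open CommutativeRing xor-∧-commutativeRing public
  using (0#; 1#)
  renaming (Carrier to ℤ₂; _+_ to _+₂_; _*_ to _*₂_; +-rawMonoid to +₂-rawMonoid)

coordinateSum : ∀ {N} → Vector ℤ₂ N → ℤ₂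
coordinateSum = sum +₂-rawMonoid

infix 7 _·_

_·_ : ∀ {N} → Vector ℤ₂ N → Vector ℤ₂ N → ℤ₂
u · w = coordinateSum (zipWith _*₂_ u w)

∑ : ∀ {A : Set} {N} → List A → (A → Vector ℤ₂ N) → Vector ℤ₂ N
∑ as v j = foldr _+₂_ 0# (map (λ a → v a j) as)

preimage : (A B : FinSet) → (Carrier B → Carrier A) → Carrier A → List (Carrier B)
preimage A B α a = filter (λ b → FinSet._≟_ A (α b) a) (elements B)

{-# OPTIONS --safe #-}

-- Write v[f] = ∑ₐ f(a) v(a) for a function f on a domain; the marginal
-- condition says that v_y[f ∘ α] = v_x[f].  For a coset constraint with relation
-- R, list for each index j ≤ N the tuples t ∈ R with v(t)ⱼ = 1, and concatenate
-- these lists over all j.  The concatenation has odd length since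
-- the coordinates of i sum to 1, so the alternating product t₁ t₂⁻¹ t₃ ⋯ of
-- the listed tuples lies in R.  View D₄ as the group of unitriangular 3 × 3
-- matrices over ℤ/2, with entries p, q next to the diagonal and corner z.  The
-- entries of a coordinate of the alternating product are sums of linear and
-- bilinear expressions in i, v[p], v[q], v[z] and v[pq], plus terms coming from
-- pairs of tuples listed for the same j; the latter cancel by orthogonality.
-- So the coordinates are determined by the marginals alone, and assigning these
-- values to the variables gives a solution.
module Submission where

open import Algebra.Bundles using (Group; CommutativeRing)
import Algebra.Construct.Pointwise as Pointwise
import Algebra.Properties.CommutativeMonoid.Sum as CommutativeMonoidSum
import Algebra.Properties.Group as GroupProperties
import Algebra.Properties.Semiring.Sum as SemiringSum
open import Data.Bool.Base using (true; false; T)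
open import Data.Bool.Properties
  using (xor-∧-commutativeRing; xor-identityʳ; ∧-zeroʳ; ∧-identityʳ)
  renaming (_≟_ to _≟ᵇ_)
open import Data.Bool.Solver using (module xor-∧-Solver)
open import Data.Fin.Base using (Fin; zero; suc)
open import Data.Fin.Patterns using (0F; 1F; 2F; 3F)
open import Data.List.Base as List using (List; []; _∷_; filter; foldr; map)
open import Data.List.Membership.Propositional using (_∈_)
open import Data.List.Membership.Propositional.Properties using (∈-lookup)
open import Data.List.Relation.Unary.All as All using (All; []; _∷_)
open import Data.List.Relation.Unary.All.Properties using (concat⁻; tabulate⁻)
open import Data.List.Relation.Unary.AllPairs as AllPairs using (AllPairs; []; _∷_)
open import Data.List.Relation.Unary.Any as Any using (here; there)
open import Data.List.Relation.Unary.Any.Properties using (lookup-index)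
open import Data.List.Relation.Unary.Unique.Propositional using (Unique)
open import Data.Nat.Base using (ℕ; zero; suc)
open import Data.Product.Base using (∃; _×_; _,_; proj₁; proj₂; map₂)
open import Data.Sum.Base using (inj₁; inj₂)
open import Data.Vec.Base as Vec using (Vec)
open import Data.Vec.Functional using (Vector)
import Data.Vec.Relation.Unary.All as VecAll
open import Data.Vec.Relation.Unary.All.Properties using (lookup⁺; lookup⁻)
open import Function.Base using (_∘_; _$_)
open import Function.Bundles using (Equivalence)
open import Level using (0ℓ)
open import Relation.Binary.PropositionalEquality
  using (_≡_; _≢_; _≗_; refl; sym; trans; cong; cong₂; subst; module ≡-Reasoning)
open import Relation.Nullary using (yes; no)
open import Relation.Nullary.Decidable using (from-yes)
open import Relation.Unary using (Pred)
open import Defs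

open CommutativeRing xor-∧-commutativeRing using (semiring; +-commutativeMonoid; +-assoc)
open SemiringSum semiring using (sum-cong-≗; *-distribˡ-sum; sum-replicate-zero)
open CommutativeMonoidSum +-commutativeMonoid using (∑-distrib-+)

-- Sums over lists and dot products over ℤ/2.

listSum : {A : Set} → List A → (A → ℤ₂) → ℤ₂
listSum as f = foldr _+₂_ 0# (map f as)

listSum-cong : ∀ {A : Set} (as : List A) {f g : A → ℤ₂} → f ≗ g →
               listSum as f ≡ listSum as g
listSum-cong []       f≗g = refl
listSum-cong (a ∷ as) f≗g = cong₂ _+₂_ (f≗g a) (listSum-cong as f≗g)

listSum-zero : ∀ {A : Set} {as : List A} {f : A → ℤ₂} →
               All (λ a → f a ≡ 0#) as → listSum as f ≡ 0#
listSum-zero []         = refl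
listSum-zero (eq ∷ eqs) = cong₂ _+₂_ eq (listSum-zero eqs)

listSum-+ : ∀ {A : Set} (as : List A) (f g : A → ℤ₂) →
            listSum as (λ a → f a +₂ g a) ≡ listSum as f +₂ listSum as g
listSum-+ []       f g = refl
listSum-+ (a ∷ as) f g = trans (cong (f a +₂ g a +₂_) (listSum-+ as f g))
  (solve 4 (λ x y s t → (x :+ y) :+ (s :+ t) := (x :+ s) :+ (y :+ t)) refl
    (f a) (g a) (listSum as f) (listSum as g))
  where open xor-∧-Solver

-- v[f] in the notation of the header.
weigh : ∀ {A : Set} {N} → List A → (A → ℤ₂) → (A → Vector ℤ₂ N) → Vector ℤ₂ N
weigh as f v = ∑ as (λ a j → f a *₂ v a j)

-- Double counting: every `b` lies in exactly one fibre of `β`, the one over `β b`. By induction on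
-- `bs`, each new `b` contributes a single term, because the enumeration of `A` contains `β b`
-- exactly once.
listSum-filter : (A : FinSet) {B : Set} (β : B → Carrier A) (f : Carrier A → ℤ₂)
  (g : B → ℤ₂) (bs : List B) →
  listSum (elements A) (λ a → f a *₂ listSum (filter (λ b → FinSet._≟_ A (β b) a) bs) g) ≡
  listSum bs (λ b → f (β b) *₂ g b)
listSum-filter A β f g [] = listSum-zero (All.universal (∧-zeroʳ ∘ f) (elements A))
listSum-filter A {B} β f g (b ∷ bs) = begin
  listSum A.elements (λ a → f a *₂ fibre a (b ∷ bs))
    ≡⟨ listSum-cong A.elements split ⟩
  listSum A.elements (λ a → at a +₂ f a *₂ fibre a bs)
    ≡⟨ listSum-+ A.elements at _ ⟩
  listSum A.elements at +₂ listSum A.elements (λ a → f a *₂ fibre a bs)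
    ≡⟨ cong₂ _+₂_ (collapse A.unique (A.complete (β b))) (listSum-filter A β f g bs) ⟩
  f (β b) *₂ g b +₂ listSum bs (λ b → f (β b) *₂ g b) ∎
  where
  module A = FinSet A
  open ≡-Reasoning

  fibre : Carrier A → List B → ℤ₂
  fibre a bs = listSum (filter (λ b → β b A.≟ a) bs) g

  at : Carrier A → ℤ₂
  at a with β b A.≟ a
  ... | yes _ = f a *₂ g b
  ... | no  _ = 0#

  split : ∀ a → f a *₂ fibre a (b ∷ bs) ≡ at a +₂ f a *₂ fibre a bs
  split a with β b A.≟ a
  ... | no  _ = refl
  ... | yes _ = solve 3 (λ x y s → x :* (y :+ s) := x :* y :+ x :* s) refl
                  (f a) (g b) (fibre a bs)
    where open xor-∧-Solver

  at-≢ : ∀ {a} → β b ≢ a → at a ≡ 0#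
  at-≢ {a} b≢a with β b A.≟ a
  ... | yes b≡a with () ← b≢a b≡a
  ... | no  _ = refl

  at-≡ : at (β b) ≡ f (β b) *₂ g b
  at-≡ with β b A.≟ β b
  ... | yes _ = refl
  ... | no b≢b with () ← b≢b refl

  collapse : ∀ {as} → Unique as → β b ∈ as → listSum as at ≡ f (β b) *₂ g b
  collapse (x∉ ∷ _) (here refl) =
    trans (cong₂ _+₂_ at-≡ (listSum-zero (All.map at-≢ x∉))) (xor-identityʳ _)
  collapse (x∉ ∷ u) (there b∈) =
    cong₂ _+₂_ (at-≢ (All.lookup x∉ b∈ ∘ sym)) (collapse u b∈)

weigh-preimage : ∀ {N} (A B : FinSet) (β : Carrier B → Carrier A)
  (f : Carrier A → ℤ₂) (u : Carrier A → Vector ℤ₂ N) (w : Carrier B → Vector ℤ₂ N) →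
  (∀ a → u a ≗ ∑ (preimage A B β a) w) →
  weigh (elements B) (f ∘ β) w ≗ weigh (elements A) f u
weigh-preimage A B β f u w u≗ j = sym (trans
  (listSum-cong (elements A) (λ a → cong (f a *₂_) (u≗ a j)))
  (listSum-filter A β f (λ b → w b j) (elements B)))

-- Linearity of the dot product in its second argument. In this form orthogonality later removes the
-- interaction of factors listed for the same coordinate.
·-weigh : ∀ {A : Set} {N} (u : Vector ℤ₂ N) (f : A → ℤ₂) (v : A → Vector ℤ₂ N) {as} →
          All (λ a → u · v a ≡ 0#) as → u · weigh as f v ≡ 0#
·-weigh {N = N} u f v [] = trans (sum-cong-≗ (∧-zeroʳ ∘ u)) (sum-replicate-zero N)
·-weigh {N = N} u f v {a ∷ as} (u⊥a ∷ u⊥as) = begin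
  coordinateSum (λ j → u j *₂ (f a *₂ v a j +₂ rest j))
    ≡⟨ sum-cong-≗ (λ j → distrib (u j) (f a) (v a j) (rest j)) ⟩
  coordinateSum (λ j → f a *₂ (u j *₂ v a j) +₂ u j *₂ rest j)
    ≡⟨ ∑-distrib-+ (λ j → f a *₂ (u j *₂ v a j)) (λ j → u j *₂ rest j) ⟩
  coordinateSum (λ j → f a *₂ (u j *₂ v a j)) +₂ u · rest
    ≡⟨ cong₂ _+₂_ (sym (*-distribˡ-sum (f a) (λ j → u j *₂ v a j))) (·-weigh u f v u⊥as) ⟩
  f a *₂ (u · v a) +₂ 0#
    ≡⟨ cong (λ s → f a *₂ s +₂ 0#) u⊥a ⟩
  f a *₂ 0# +₂ 0#
    ≡⟨ cong (_+₂ 0#) (∧-zeroʳ (f a)) ⟩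
  0# ∎
  where
  open ≡-Reasoning
  rest : Vector ℤ₂ N
  rest = weigh as f v

  distrib : ∀ x c y r → x *₂ (c *₂ y +₂ r) ≡ c *₂ (x *₂ y) +₂ x *₂ r
  distrib = solve 4 (λ x c y r → x :* (c :* y :+ r) := c :* (x :* y) :+ x :* r) refl
    where open xor-∧-Solver

-- ∑ uⱼ wₖ over j < k.
τ : ∀ {N} → Vector ℤ₂ N → Vector ℤ₂ N → ℤ₂
τ {zero}  u w = 0#
τ {suc N} u w = u zero *₂ coordinateSum (w ∘ suc) +₂ τ (u ∘ suc) (w ∘ suc)

τ-cong : ∀ {N} {u u′ w w′ : Vector ℤ₂ N} → u ≗ u′ → w ≗ w′ → τ u w ≡ τ u′ w′
τ-cong {zero}  u≗ w≗ = refl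
τ-cong {suc N} u≗ w≗ = cong₂ _+₂_
  (cong₂ _*₂_ (u≗ zero) (sum-cong-≗ (w≗ ∘ suc)))
  (τ-cong (u≗ ∘ suc) (w≗ ∘ suc))

-- Alternating products in groups and in their cosets.

-- The alternating product of the elements t b over all pairs (j , b) with
-- w b j = 1, in lexicographic order, together with the parity of its length.
-- The exponent of the last factor is 1.
module _ (G : Group 0ℓ 0ℓ) where
  open Group G using (ε) renaming (Carrier to ∣G∣; _∙_ to _∘ᴳ_; _⁻¹ to _⁻¹ᴳ)

  push : ℤ₂ → ∣G∣ → ℤ₂ × ∣G∣ → ℤ₂ × ∣G∣
  push false t σ           = σ
  push true  t (false , y) = true  , t ∘ᴳ y
  push true  t (true  , y) = false , t ⁻¹ᴳ ∘ᴳ y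

  pushAll : {B : Set} → List B → (B → ℤ₂) → (B → ∣G∣) → ℤ₂ × ∣G∣ → ℤ₂ × ∣G∣
  pushAll []       w t σ = σ
  pushAll (b ∷ bs) w t σ = push (w b) (t b) (pushAll bs w t σ)

  alternating : ∀ {B : Set} {N} → List B → (B → Vector ℤ₂ N) → (B → ∣G∣) → ℤ₂ × ∣G∣
  alternating {N = zero}  bs w t = 0# , ε
  alternating {N = suc N} bs w t =
    pushAll bs (λ b → w b zero) t (alternating bs (λ b → w b ∘ suc) t)

  push-parity : ∀ w t σ → proj₁ (push w t σ) ≡ w +₂ proj₁ σ
  push-parity false t σ           = refl
  push-parity true  t (false , y) = refl
  push-parity true  t (true  , y) = refl

  pushAll-parity : ∀ {B : Set} (bs : List B) w t σ →
                   proj₁ (pushAll bs w t σ) ≡ listSum bs w +₂ proj₁ σ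
  pushAll-parity []       w t σ = refl
  pushAll-parity (b ∷ bs) w t σ = trans (push-parity (w b) (t b) (pushAll bs w t σ))
    (trans (cong (w b +₂_) (pushAll-parity bs w t σ))
      (sym (+-assoc (w b) (listSum bs w) (proj₁ σ))))

  alternating-parity : ∀ {B : Set} {N} (bs : List B) (w : B → Vector ℤ₂ N) t →
                       proj₁ (alternating bs w t) ≡ coordinateSum (∑ bs w)
  alternating-parity {N = zero}  bs w t = refl
  alternating-parity {N = suc N} bs w t = trans
    (pushAll-parity bs (λ b → w b zero) t (alternating bs (λ b → w b ∘ suc) t))
    (cong (listSum bs (λ b → w b zero) +₂_) (alternating-parity bs (λ b → w b ∘ suc) t))

  IsCoset-respects : ∀ {S : Pred ∣G∣ 0ℓ} → IsCoset G S →
                     ∀ {x y} → Group._≈_ G x y → S x → S y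
  IsCoset-respects (H , _ , g , S⇔) {x} {y} x≈y Sx =
    let h , Hh , x≈gh = Equivalence.to (S⇔ x) Sx in
    Equivalence.from (S⇔ y) (h , Hh , Group.trans G (Group.sym G x≈y) x≈gh)

  -- For elements `g h₁`, `g h₂`, `g h₃` the inner factors `g⁻¹` and `g` cancel, leaving
  -- `g h₁ h₂⁻¹ h₃`. This closure keeps odd alternating products inside the coset.
  IsCoset-heap : ∀ {S : Pred ∣G∣ 0ℓ} → IsCoset G S →
                 ∀ {x y z} → S x → S y → S z → S (x ∘ᴳ (y ⁻¹ᴳ ∘ᴳ z))
  IsCoset-heap (H , H≤G , g , S⇔) {x} {y} {z} Sx Sy Sz
    with h₁ , H₁ , x≈ ← Equivalence.to (S⇔ x) Sx
       | h₂ , H₂ , y≈ ← Equivalence.to (S⇔ y) Sy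
       | h₃ , H₃ , z≈ ← Equivalence.to (S⇔ z) Sz =
    Equivalence.from (S⇔ _)
      (h₁ ∘ᴳ (h₂ ⁻¹ᴳ ∘ᴳ h₃) , ∙-closed H₁ (∙-closed (⁻¹-closed H₂) H₃) , (begin
      x ∘ᴳ (y ⁻¹ᴳ ∘ᴳ z)
        ≈⟨ ∙-cong x≈ (∙-cong (⁻¹-cong y≈) z≈) ⟩
      (g ∘ᴳ h₁) ∘ᴳ ((g ∘ᴳ h₂) ⁻¹ᴳ ∘ᴳ (g ∘ᴳ h₃))
        ≈⟨ ∙-congˡ (∙-congʳ (⁻¹-anti-homo-∙ g h₂)) ⟩
      (g ∘ᴳ h₁) ∘ᴳ ((h₂ ⁻¹ᴳ ∘ᴳ g ⁻¹ᴳ) ∘ᴳ (g ∘ᴳ h₃))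
        ≈⟨ ∙-congˡ (assoc _ _ _) ⟩
      (g ∘ᴳ h₁) ∘ᴳ (h₂ ⁻¹ᴳ ∘ᴳ (g ⁻¹ᴳ ∘ᴳ (g ∘ᴳ h₃)))
        ≈⟨ ∙-congˡ (∙-congˡ (\\-leftDividesʳ g h₃)) ⟩
      (g ∘ᴳ h₁) ∘ᴳ (h₂ ⁻¹ᴳ ∘ᴳ h₃)
        ≈⟨ assoc _ _ _ ⟩
      g ∘ᴳ (h₁ ∘ᴳ (h₂ ⁻¹ᴳ ∘ᴳ h₃)) ∎))
    where
    open IsSubgroup H≤G
    open Group G using (∙-cong; ∙-congˡ; ∙-congʳ; ⁻¹-cong; assoc)
    open GroupProperties G using (⁻¹-anti-homo-∙; \\-leftDividesʳ)
    open import Relation.Binary.Reasoning.Setoid (Group.setoid G)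

  module _ {S : Pred ∣G∣ 0ℓ} (coset : IsCoset G S) where

    -- For a coset S = g H, the second case says y ∈ H.
    Reachable : ℤ₂ × ∣G∣ → Set
    Reachable (true  , y) = S y
    Reachable (false , y) = ∀ {x} → S x → S (x ∘ᴳ y)

    push-reachable : ∀ w {t} σ → S t → Reachable σ → Reachable (push w t σ)
    push-reachable false σ           St r  = r
    push-reachable true  (false , y) St r  = r St
    -- Here `t⁻¹ y` is a quotient of two elements of `S`, so right multiplication by it preserves
    -- `S`.
    push-reachable true  (true  , y) St Sy = λ Sx → IsCoset-heap coset Sx St Sy

    pushAll-reachable : ∀ {B : Set} (bs : List B) w {t} σ → (∀ b → S (t b)) →
                        Reachable σ → Reachable (pushAll bs w t σ)
    pushAll-reachable []       w σ St r = r
    pushAll-reachable (b ∷ bs) w σ St r =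
      push-reachable (w b) (pushAll bs w _ σ) (St b) (pushAll-reachable bs w σ St r)

    alternating-reachable : ∀ {B : Set} {N} (bs : List B) (w : B → Vector ℤ₂ N) {t} →
                            (∀ b → S (t b)) → Reachable (alternating bs w t)
    -- The empty product has even length, and `x ε` agrees with `x` only up to the group's equality.
    alternating-reachable {N = zero}  bs w St =
      IsCoset-respects coset (Group.sym G (Group.identityʳ G _))
    alternating-reachable {N = suc N} bs w St = pushAll-reachable bs (λ b → w b zero)
      (alternating bs (λ b → w b ∘ suc) _) St (alternating-reachable bs (λ b → w b ∘ suc) St)

    odd-alternating : ∀ {B : Set} {N} (bs : List B) (w : B → Vector ℤ₂ N) {t} →
      (∀ b → S (t b)) → coordinateSum (∑ bs w) ≡ 1# → S (proj₂ (alternating bs w t))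
    odd-alternating bs w {t} St odd
      with alternating bs w t | alternating-parity bs w t | alternating-reachable bs w {t} St
    ... | true  , y | _      | Sy = Sy
    -- An even length would make the sum of coordinates 0.
    ... | false , y | parity | _ with () ← trans parity odd

D₄^ : ℕ → Group 0ℓ 0ℓ
D₄^ n = Pointwise.group (Fin n) D₄-group

module _ {n} (k : Fin n) where

  push-at : ∀ w t σ → map₂ (_$ k) (push (D₄^ n) w t σ) ≡ push D₄-group w (t k) (map₂ (_$ k) σ)
  push-at false t σ           = refl
  push-at true  t (false , y) = refl
  push-at true  t (true  , y) = refl

  pushAll-at : ∀ {B : Set} (bs : List B) w t σ →
    map₂ (_$ k) (pushAll (D₄^ n) bs w t σ) ≡
    pushAll D₄-group bs w (λ b → t b k) (map₂ (_$ k) σ)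
  pushAll-at []       w t σ = refl
  pushAll-at (b ∷ bs) w t σ = trans (push-at (w b) (t b) (pushAll (D₄^ n) bs w t σ))
    (cong (push D₄-group (w b) (t b k)) (pushAll-at bs w t σ))

  -- The exponents depend on `w` alone and the operations of a power are coordinatewise, so each
  -- coordinate is an alternating product in `D₄` with the same pattern.
  alternating-at : ∀ {B : Set} {N} (bs : List B) (w : B → Vector ℤ₂ N) t →
    map₂ (_$ k) (alternating (D₄^ n) bs w t) ≡ alternating D₄-group bs w (λ b → t b k)
  alternating-at {N = zero}  bs w t = refl
  alternating-at {N = suc N} bs w t = trans
    (pushAll-at bs (λ b → w b zero) t (alternating (D₄^ n) bs (λ b → w b ∘ suc) t))
    (cong (pushAll D₄-group bs (λ b → w b zero) (λ b → t b k))
      (alternating-at bs (λ b → w b ∘ suc) t))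

-- Matrix entries of alternating products in `D₄`.

-- The isomorphism of D₄ with the unitriangular 3 × 3 matrices over ℤ/2 that
-- sends the rotation 1 to p = q = 1, z = 0 and the reflection 0 to p = z = 0,
-- q = 1.
p q z pq : D₄ → ℤ₂

p (rot 0F) = 0#
p (rot 1F) = 1#
p (rot 2F) = 0#
p (rot 3F) = 1#
p (ref 0F) = 0#
p (ref 1F) = 1#
p (ref 2F) = 0#
p (ref 3F) = 1#

q (rot 0F) = 0#
q (rot 1F) = 1#
q (rot 2F) = 0#
q (rot 3F) = 1#
q (ref 0F) = 1#
q (ref 1F) = 0#
q (ref 2F) = 1#
q (ref 3F) = 0#

z (rot 0F) = 0#
z (rot 1F) = 0#
z (rot 2F) = 1#
z (rot 3F) = 1#
z (ref 0F) = 0#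
z (ref 1F) = 1#
z (ref 2F) = 1#
z (ref 3F) = 0#

pq g = p g *₂ q g

decode : ℤ₂ → ℤ₂ → ℤ₂ → D₄
decode false false false = rot 0F
decode true  true  false = rot 1F
decode false false true  = rot 2F
decode true  true  true  = rot 3F
decode false true  false = ref 0F
decode true  false true  = ref 1F
decode false true  true  = ref 2F
decode true  false false = ref 3F

decode-entries : ∀ g → decode (p g) (q g) (z g) ≡ g
decode-entries = from-yes (∀D₄? λ g → decode (p g) (q g) (z g) ≟D₄ g)

p-homo : ∀ g h → p (g ∙ h) ≡ p g +₂ p h
p-homo = from-yes (∀D₄? λ g → ∀D₄? λ h → p (g ∙ h) ≟ᵇ p g +₂ p h)

q-homo : ∀ g h → q (g ∙ h) ≡ q g +₂ q h
q-homo = from-yes (∀D₄? λ g → ∀D₄? λ h → q (g ∙ h) ≟ᵇ q g +₂ q h)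

z-∙ : ∀ g h → z (g ∙ h) ≡ z g +₂ p g *₂ q h +₂ z h
z-∙ = from-yes (∀D₄? λ g → ∀D₄? λ h → z (g ∙ h) ≟ᵇ z g +₂ p g *₂ q h +₂ z h)

p-⁻¹ : ∀ g → p (g ⁻¹) ≡ p g
p-⁻¹ = from-yes (∀D₄? λ g → p (g ⁻¹) ≟ᵇ p g)

q-⁻¹ : ∀ g → q (g ⁻¹) ≡ q g
q-⁻¹ = from-yes (∀D₄? λ g → q (g ⁻¹) ≟ᵇ q g)

-- The inverse of a unitriangular matrix over ℤ/2 has corner `z + pq`; this is how `pq` enters.
z-⁻¹∙ : ∀ g h → z (g ⁻¹ ∙ h) ≡ z g +₂ pq g +₂ p g *₂ q h +₂ z h
z-⁻¹∙ = from-yes (∀D₄? λ g → ∀D₄? λ h →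
  z (g ⁻¹ ∙ h) ≟ᵇ z g +₂ pq g +₂ p g *₂ q h +₂ z h)

module _ (f : D₄ → ℤ₂) (f-homo : ∀ g h → f (g ∙ h) ≡ f g +₂ f h)
         (f-⁻¹ : ∀ g → f (g ⁻¹) ≡ f g) where

  -- A homomorphism to ℤ/2 does not see the sign of the exponent, only whether the factor is
  -- present.
  push-homo : ∀ w t σ → f (proj₂ (push D₄-group w t σ)) ≡ f t *₂ w +₂ f (proj₂ σ)
  push-homo false t σ           = cong (_+₂ f (proj₂ σ)) (sym (∧-zeroʳ (f t)))
  push-homo true  t (false , y) =
    trans (f-homo t y) (cong (_+₂ f y) (sym (∧-identityʳ (f t))))
  push-homo true  t (true  , y) =
    trans (f-homo (t ⁻¹) y) (cong (_+₂ f y) (trans (f-⁻¹ t) (sym (∧-identityʳ (f t)))))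

  pushAll-homo : ∀ {B : Set} (bs : List B) w t σ →
    f (proj₂ (pushAll D₄-group bs w t σ)) ≡
    listSum bs (λ b → f (t b) *₂ w b) +₂ f (proj₂ σ)
  pushAll-homo []       w t σ = refl
  pushAll-homo (b ∷ bs) w t σ = trans (push-homo (w b) (t b) (pushAll D₄-group bs w t σ))
    (trans (cong (f (t b) *₂ w b +₂_) (pushAll-homo bs w t σ))
      (sym (+-assoc (f (t b) *₂ w b) (listSum bs (λ b → f (t b) *₂ w b)) (f (proj₂ σ)))))

  alternating-homo : f 1D₄ ≡ 0# →
    ∀ {B : Set} {N} (bs : List B) (w : B → Vector ℤ₂ N) t →
    f (proj₂ (alternating D₄-group bs w t)) ≡ coordinateSum (weigh bs (f ∘ t) w)
  alternating-homo f-1 {N = zero}  bs w t = f-1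
  alternating-homo f-1 {N = suc N} bs w t = trans
    (pushAll-homo bs (λ b → w b zero) t (alternating D₄-group bs (λ b → w b ∘ suc) t))
    (cong (listSum bs (λ b → f (t b) *₂ w b zero) +₂_)
      (alternating-homo f-1 bs (λ b → w b ∘ suc) t))

-- The exponent is -1 exactly when the parity `proj₁ σ` of the factors to the right is 1;
-- multiplying `pq t` by this parity unites the two cases.
push-z : ∀ w t σ → z (proj₂ (push D₄-group w t σ)) ≡
  w *₂ (z t +₂ pq t *₂ proj₁ σ +₂ p t *₂ q (proj₂ σ)) +₂ z (proj₂ σ)
push-z false t σ           = refl
push-z true  t (false , y) = trans (z-∙ t y)
  (cong (λ s → s +₂ p t *₂ q y +₂ z y)
    (sym (trans (cong (z t +₂_) (∧-zeroʳ (pq t))) (xor-identityʳ (z t)))))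
push-z true  t (true  , y) = trans (z-⁻¹∙ t y)
  (cong (λ s → z t +₂ s +₂ p t *₂ q y +₂ z y) (sym (∧-identityʳ (pq t))))

-- The contribution to z of pairs of factors b , b′ with the same j.
excess : {B : Set} → List B → (B → ℤ₂) → (B → D₄) → ℤ₂
excess []       w t = 0#
excess (b ∷ bs) w t =
  pq (t b) *₂ (w b *₂ listSum bs w) +₂
  p (t b) *₂ (w b *₂ listSum bs (λ b′ → q (t b′) *₂ w b′)) +₂
  excess bs w t

pushAll-z : ∀ {B : Set} (bs : List B) w t σ → z (proj₂ (pushAll D₄-group bs w t σ)) ≡
  listSum bs (λ b → z (t b) *₂ w b) +₂
  listSum bs (λ b → pq (t b) *₂ w b) *₂ proj₁ σ +₂
  listSum bs (λ b → p (t b) *₂ w b) *₂ q (proj₂ σ) +₂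
  excess bs w t +₂ z (proj₂ σ)
pushAll-z []       w t σ = refl
pushAll-z (b ∷ bs) w t σ = begin
  z (proj₂ (push D₄-group (w b) (t b) σ′))
    ≡⟨ push-z (w b) (t b) σ′ ⟩
  w b *₂ (z (t b) +₂ pq (t b) *₂ proj₁ σ′ +₂ p (t b) *₂ q (proj₂ σ′)) +₂ z (proj₂ σ′)
    ≡⟨ cong₂ _+₂_
         (cong (w b *₂_) (cong₂ _+₂_
           (cong (λ e → z (t b) +₂ pq (t b) *₂ e) (pushAll-parity D₄-group bs w t σ))
           (cong (p (t b) *₂_) (pushAll-homo q q-homo q-⁻¹ bs w t σ))))
         (pushAll-z bs w t σ) ⟩
  w b *₂ (z (t b) +₂ pq (t b) *₂ (listSum bs w +₂ proj₁ σ) +₂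
          p (t b) *₂ (listSum bs (λ b → q (t b) *₂ w b) +₂ q (proj₂ σ))) +₂
  (listSum bs (λ b → z (t b) *₂ w b) +₂
   listSum bs (λ b → pq (t b) *₂ w b) *₂ proj₁ σ +₂
   listSum bs (λ b → p (t b) *₂ w b) *₂ q (proj₂ σ) +₂
   excess bs w t +₂ z (proj₂ σ))
    -- The parity and the `q`-entry of `σ′` split into a part from `bs` and a part from `σ`. The
    -- part from `bs` goes into the excess.
    ≡⟨ solve 13 (λ w zt pqt pt W Wq Wz Wpq Wp e Q X Z →
         w :* (zt :+ pqt :* (W :+ e) :+ pt :* (Wq :+ Q)) :+
         (Wz :+ Wpq :* e :+ Wp :* Q :+ X :+ Z) :=
         (zt :* w :+ Wz) :+ (pqt :* w :+ Wpq) :* e :+ (pt :* w :+ Wp) :* Q :+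
         (pqt :* (w :* W) :+ pt :* (w :* Wq) :+ X) :+ Z) refl
         (w b) (z (t b)) (pq (t b)) (p (t b)) (listSum bs w)
         (listSum bs (λ b → q (t b) *₂ w b)) (listSum bs (λ b → z (t b) *₂ w b))
         (listSum bs (λ b → pq (t b) *₂ w b)) (listSum bs (λ b → p (t b) *₂ w b))
         (proj₁ σ) (q (proj₂ σ)) (excess bs w t) (z (proj₂ σ)) ⟩
  _ ∎
  where
  open ≡-Reasoning
  open xor-∧-Solver
  σ′ : ℤ₂ × D₄
  σ′ = pushAll D₄-group bs w t σ

-- Each factor interacts with the factors to its right: those listed for a later coordinate give the
-- two `τ` terms, those for the same coordinate the excess.
alternating-z : ∀ {B : Set} {N} (bs : List B) (w : B → Vector ℤ₂ N) t →
  z (proj₂ (alternating D₄-group bs w t)) ≡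
  coordinateSum (weigh bs (z ∘ t) w) +₂ τ (weigh bs (pq ∘ t) w) (∑ bs w) +₂
  τ (weigh bs (p ∘ t) w) (weigh bs (q ∘ t) w) +₂
  coordinateSum (λ j → excess bs (λ b → w b j) t)
alternating-z {N = zero}  bs w t = refl
alternating-z {B} {N = suc N} bs w t = begin
  z (proj₂ (pushAll D₄-group bs w₀ t σ))
    ≡⟨ pushAll-z bs w₀ t σ ⟩
  W z +₂ W pq *₂ proj₁ σ +₂ W p *₂ q (proj₂ σ) +₂ excess bs w₀ t +₂ z (proj₂ σ)
    ≡⟨ cong₂ _+₂_
         (cong (_+₂ excess bs w₀ t) (cong₂ _+₂_
           (cong (λ e → W z +₂ W pq *₂ e) (alternating-parity D₄-group bs w₊ t))
           (cong (W p *₂_) (alternating-homo q q-homo q-⁻¹ refl bs w₊ t))))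
         (alternating-z bs w₊ t) ⟩
  W z +₂ W pq *₂ coordinateSum (∑ bs w₊) +₂
  W p *₂ coordinateSum (weigh bs (q ∘ t) w₊) +₂ excess bs w₀ t +₂
  (coordinateSum (weigh bs (z ∘ t) w₊) +₂ τ (weigh bs (pq ∘ t) w₊) (∑ bs w₊) +₂
   τ (weigh bs (p ∘ t) w₊) (weigh bs (q ∘ t) w₊) +₂
   coordinateSum (λ j → excess bs (λ b → w₊ b j) t))
    ≡⟨ solve 8 (λ a b c d a′ b′ c′ d′ →
         a :+ b :+ c :+ d :+ (a′ :+ b′ :+ c′ :+ d′) :=
         (a :+ a′) :+ (b :+ b′) :+ (c :+ c′) :+ (d :+ d′)) refl
         (W z) (W pq *₂ coordinateSum (∑ bs w₊))
         (W p *₂ coordinateSum (weigh bs (q ∘ t) w₊)) (excess bs w₀ t)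
         (coordinateSum (weigh bs (z ∘ t) w₊)) (τ (weigh bs (pq ∘ t) w₊) (∑ bs w₊))
         (τ (weigh bs (p ∘ t) w₊) (weigh bs (q ∘ t) w₊))
         (coordinateSum (λ j → excess bs (λ b → w₊ b j) t)) ⟩
  _ ∎
  where
  open ≡-Reasoning
  open xor-∧-Solver
  w₀ : B → ℤ₂
  w₀ b = w b zero
  w₊ : B → Vector ℤ₂ N
  w₊ b = w b ∘ suc
  σ : ℤ₂ × D₄
  σ = alternating D₄-group bs w₊ t
  W : (D₄ → ℤ₂) → ℤ₂
  W f = listSum bs (λ b → f (t b) *₂ w₀ b)

-- Summing over `j` turns the products of `w b j` and `w b′ j` into dot products, which vanish for
-- distinct positions in the list.
∑-excess : ∀ {B : Set} {N} {bs : List B} (w : B → Vector ℤ₂ N) t →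
  AllPairs (λ b b′ → w b · w b′ ≡ 0#) bs →
  coordinateSum (λ j → excess bs (λ b → w b j) t) ≡ 0#
∑-excess {N = N} w t [] = sum-replicate-zero N
∑-excess {N = N} {b ∷ bs} w t (b⊥bs ∷ ⊥bs) = begin
  coordinateSum (λ j → P j +₂ Q j +₂ X j)
    ≡⟨ ∑-distrib-+ (λ j → P j +₂ Q j) X ⟩
  coordinateSum (λ j → P j +₂ Q j) +₂ coordinateSum X
    ≡⟨ cong₂ _+₂_ (∑-distrib-+ P Q) (∑-excess w t ⊥bs) ⟩
  coordinateSum P +₂ coordinateSum Q +₂ 0#
    -- `P` is the case of constant weight 1, since multiplication by `1#` on the left reduces away.
    ≡⟨ cong (_+₂ 0#) (cong₂ _+₂_ (vanish (pq (t b)) (λ _ → 1#)) (vanish (p (t b)) (q ∘ t))) ⟩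
  0# ∎
  where
  open ≡-Reasoning
  P Q X : Vector ℤ₂ N
  P j = pq (t b) *₂ (w b j *₂ ∑ bs w j)
  Q j = p (t b) *₂ (w b j *₂ weigh bs (q ∘ t) w j)
  X j = excess bs (λ b → w b j) t

  vanish : ∀ c f → coordinateSum (λ j → c *₂ (w b j *₂ weigh bs f w j)) ≡ 0#
  vanish c f = begin
    coordinateSum (λ j → c *₂ (w b j *₂ weigh bs f w j))
      ≡⟨ *-distribˡ-sum c (λ j → w b j *₂ weigh bs f w j) ⟨
    c *₂ (w b · weigh bs f w)
      ≡⟨ cong (c *₂_) (·-weigh (w b) f w b⊥bs) ⟩
    c *₂ 0#
      ≡⟨ ∧-zeroʳ c ⟩
    0# ∎

-- The entries found for an alternating product, without the excess. They involve only `i` and the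
-- vectors `v[f]`, so the same formula applies at a variable and at a constraint.
value : ∀ {N} → Vector ℤ₂ N → ((D₄ → ℤ₂) → Vector ℤ₂ N) → D₄
value i v[_] = decode (coordinateSum v[ p ]) (coordinateSum v[ q ])
  (coordinateSum v[ z ] +₂ τ v[ pq ] i +₂ τ v[ p ] v[ q ])

value-cong : ∀ {N} {i i′ : Vector ℤ₂ N} {v v′ : (D₄ → ℤ₂) → Vector ℤ₂ N} →
             i ≗ i′ → (∀ f → v f ≗ v′ f) → value i v ≡ value i′ v′
value-cong i≗ v≗
  rewrite sum-cong-≗ (v≗ p) | sum-cong-≗ (v≗ q) | sum-cong-≗ (v≗ z)
        | τ-cong (v≗ pq) i≗ | τ-cong (v≗ p) (v≗ q) = refl

alternating-value : ∀ {B : Set} {N} {bs : List B} (w : B → Vector ℤ₂ N) t →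
  AllPairs (λ b b′ → w b · w b′ ≡ 0#) bs →
  proj₂ (alternating D₄-group bs w t) ≡ value (∑ bs w) (λ f → weigh bs (f ∘ t) w)
alternating-value {bs = bs} w t ⊥bs = begin
  g
    ≡⟨ decode-entries g ⟨
  decode (p g) (q g) (z g)
    ≡⟨ cong (λ a → decode a (q g) (z g)) (alternating-homo p p-homo p-⁻¹ refl bs w t) ⟩
  decode (coordinateSum (weigh bs (p ∘ t) w)) (q g) (z g)
    ≡⟨ cong₂ (decode (coordinateSum (weigh bs (p ∘ t) w)))
         (alternating-homo q q-homo q-⁻¹ refl bs w t) z-entry ⟩
  value (∑ bs w) (λ f → weigh bs (f ∘ t) w) ∎
  where
  open ≡-Reasoning
  g : D₄
  g = proj₂ (alternating D₄-group bs w t)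

  c : ℤ₂
  c = coordinateSum (weigh bs (z ∘ t) w) +₂ τ (weigh bs (pq ∘ t) w) (∑ bs w) +₂
      τ (weigh bs (p ∘ t) w) (weigh bs (q ∘ t) w)

  z-entry : z g ≡ c
  z-entry = trans (alternating-z bs w t)
    (trans (cong (c +₂_) (∑-excess w t ⊥bs)) (xor-identityʳ c))

-- Tuples as functions of the index.

lookup⁻-cong : ∀ {A : Set} {P : Pred A 0ℓ} {n} {xs : Vec A n}
  {f g : ∀ i → P (Vec.lookup xs i)} → (∀ i → f i ≡ g i) →
  lookup⁻ {P = P} {xs = xs} f ≡ lookup⁻ g
lookup⁻-cong {xs = Vec.[]}    eq = refl
lookup⁻-cong {xs = _ Vec.∷ _} eq = cong₂ VecAll._∷_ (eq zero) (lookup⁻-cong (eq ∘ suc))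

lookup⁻∘lookup⁺ : ∀ {A : Set} {P : Pred A 0ℓ} {n} {xs : Vec A n} (pxs : VecAll.All P xs) →
                  lookup⁻ (lookup⁺ pxs) ≡ pxs
lookup⁻∘lookup⁺ VecAll.[]         = refl
lookup⁻∘lookup⁺ (px VecAll.∷ pxs) = cong (px VecAll.∷_) (lookup⁻∘lookup⁺ pxs)

lookup⁻-universal : ∀ {A : Set} {P : Pred A 0ℓ} {n} (f : ∀ x → P x) (xs : Vec A n) →
                    lookup⁻ (λ i → f (Vec.lookup xs i)) ≡ VecAll.universal f xs
lookup⁻-universal f Vec.[]       = refl
lookup⁻-universal f (x Vec.∷ xs) = cong (f x VecAll.∷_) (lookup⁻-universal f xs)

-- Solution of the instance.

module _ {V : FinSet} (C : Constraint V (λ _ → D₄-finSet)) where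
  open Constraint C

  private
    R : FinSet
    R = subset (∏ᶠ (λ _ → D₄-finSet) scope) relation

    π : Fin arity → Carrier R → D₄
    π k (t , _) = lookup⁺ t k

  -- The alternating product of the tuples of `R` lies in `R` by oddness. By the marginal condition
  -- its coordinate `k` is the value assigned to the variable at position `k` of the scope.
  coset-satisfied : IsCosetConstraint C →
    ∀ {N} (i : Vector ℤ₂ N) (v : Carrier V → D₄ → Vector ℤ₂ N)
    (w : Carrier R → Vector ℤ₂ N) →
    coordinateSum i ≡ 1# →
    ∑ (elements R) w ≗ i →
    (∀ a b → a ≢ b → w a · w b ≡ 0#) →
    (∀ k a → v (Vec.lookup scope k) a ≗ ∑ (preimage D₄-finSet R (π k) a) w) →
    Satisfies (λ x → value i (λ f → weigh (elements D₄-finSet) f (v x))) C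
  coset-satisfied coset i v w odd ∑w≗i orth marginal =
    subst (T ∘ relation) tuple≡ (odd-alternating (D₄^ arity) coset (elements R) w
      (λ (t , Rt) → subst (T ∘ relation) (sym (lookup⁻∘lookup⁺ t)) Rt)
      (trans (sum-cong-≗ ∑w≗i) odd))
    where
    open ≡-Reasoning
    s : Carrier V → D₄
    s x = value i (λ f → weigh (elements D₄-finSet) f (v x))

    y : Fin arity → D₄
    y = proj₂ (alternating (D₄^ arity) (elements R) w (λ (t , _) → lookup⁺ t))

    y≗s : ∀ k → y k ≡ s (Vec.lookup scope k)
    y≗s k = begin
      y k
        ≡⟨ cong proj₂ (alternating-at k (elements R) w (λ (t , _) → lookup⁺ t)) ⟩
      proj₂ (alternating D₄-group (elements R) w (π k))
        -- The enumeration of `R` has no repetitions, so entries at different positions are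
        -- orthogonal.
        ≡⟨ alternating-value w (π k) (AllPairs.map (orth _ _) (FinSet.unique R)) ⟩
      value (∑ (elements R) w) (λ f → weigh (elements R) (f ∘ π k) w)
        ≡⟨ value-cong ∑w≗i (λ f → weigh-preimage D₄-finSet R (π k) f
             (v (Vec.lookup scope k)) w (marginal k)) ⟩
      s (Vec.lookup scope k) ∎

    tuple≡ : lookup⁻ y ≡ VecAll.universal s scope
    tuple≡ = trans (lookup⁻-cong y≗s) (lookup⁻-universal s scope)

mainTheorem6 : (V : FinSet) (I : CSP V (λ _ → D₄-finSet)) →
    All IsCosetConstraint (CSP.constraints I) →
    let open LC (lc I) in
    (N : ℕ) (i : Vector ℤ₂ N) (v : (x : Carrier X) → Carrier (Dom x) → Vector ℤ₂ N) →
    coordinateSum i ≡ 1# →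
    (∀ x → ∑ (elements (Dom x)) (v x) ≗ i) →
    (∀ x a b → a ≢ b → v x a · v x b ≡ 0#) →
    All (λ c → let open LCConstraint c in
    ∀ a → v x a ≗ ∑ (preimage (Dom x) (Dom y) α a) (v y))
    constraints →
    ∃ (IsSolution I)
mainTheorem6 V I cosets N i v odd ∑v≗i orth marginal =
  -- Constraints are addressed by position because the new variables of `lc I` are positions in the
  -- constraint list.
  s , All.tabulate (λ C∈ → subst (Satisfies s) (sym (lookup-index C∈)) (satisfied (Any.index C∈)))
  where
  open CSP I
  s : Carrier V → D₄
  s x = value i (λ f → weigh (elements D₄-finSet) f (v (inj₁ x)))

  satisfied : ∀ c → Satisfies s (List.lookup constraints c)
  satisfied c = coset-satisfied (List.lookup constraints c)
    (All.lookup cosets (∈-lookup c)) i (v ∘ inj₁) (v (inj₂ c)) odd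
    -- The constraints of `lc I` are grouped by `c` and then by index, so undoing the concatenation
    -- yields the marginal conditions of the projections of `c`.
    (∑v≗i (inj₂ c)) (orth (inj₂ c)) (tabulate⁻ (tabulate⁻ (concat⁻ marginal) c))
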